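{- There exists an absolute constant $c>0$ such that for every positive integer $k$, setting $n=2^{2k}+1$, one has $T(n)\ge n^{cn}$. (That is, $T(n)\ge n^{\Omega(n)}$ for $n$ of the form $4^k+1$.)
   Context: Index the rows and columns of an $n\times n$ board by $\mathbb{Z}_n$. A toroidal $n$-queens configuration is a set $\{(x_i,y_i)\}_{i=1}^n\subseteq \mathbb{Z}_n^2$ such that each of the multisets $\{x_i\}$, $\{y_i\}$, $\{x_i+y_i\}$, $\{x_i-y_i\}$ equals $\mathbb{Z}_n$ (i.e. no two queens share a row, a column, or a toroidal diagonal $\{x+y=c\}$ or $\{x-y=c\}$). $T(n)$ denotes the number of toroidal $n$-queens configurations. -}

module Defs where

open import Data.Nat using (ℕ; zero; suc; _+_; _∸_; _%_)
import Data.Nat as ℕ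
open import Data.Fin using (Fin; toℕ)
import Data.Fin as F
open import Data.Fin.Properties using (all?)
open import Data.Vec using (Vec; []; _∷_; lookup)
open import Data.List using (List; [_]; map; concatMap; allFin; filter; length)
open import Data.Product using (_×_; _,_)
open import Relation.Binary.PropositionalEquality using (_≡_)
open import Relation.Nullary using (Dec; _×-dec_; _→-dec_)

-- A toroidal n-queens configuration, for n = suc m, is represented by the
-- function x ↦ y assigning to each row x ∈ ℤ_n the column of its (unique)
-- queen (rows are distinct and there are n queens, so each row has exactly one).
-- Elements of ℤ_n are Fin n; addition/subtraction mod n are computed on ℕ.

Injective : {n : ℕ} → (Fin n → ℕ) → Set
Injective {n} g = (i j : Fin n) → g i ≡ g j → i ≡ j

injective? : {n : ℕ} (g : Fin n → ℕ) → Dec (Injective g)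
injective? g = all? (λ i → all? (λ j → (g i ℕ.≟ g j) →-dec (i F.≟ j)))

IsToroidal : (m : ℕ) → Vec (Fin (suc m)) (suc m) → Set
IsToroidal m v =
  Injective (λ x → toℕ (lookup v x)) ×
  Injective (λ x → (toℕ x + toℕ (lookup v x)) % suc m) ×
  Injective (λ x → (toℕ x + (suc m ∸ toℕ (lookup v x))) % suc m)

isToroidal? : (m : ℕ) (v : Vec (Fin (suc m)) (suc m)) → Dec (IsToroidal m v)
isToroidal? m v =
  injective? (λ x → toℕ (lookup v x)) ×-dec
  (injective? (λ x → (toℕ x + toℕ (lookup v x)) % suc m) ×-dec
   injective? (λ x → (toℕ x + (suc m ∸ toℕ (lookup v x))) % suc m))

allVecs : (l k : ℕ) → List (Vec (Fin k) l)
allVecs zero    k = [ [] ]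
allVecs (suc l) k = concatMap (λ v → map (_∷ v) (allFin k)) (allVecs l k)

T : ℕ → ℕ
T zero    = 1   -- the empty configuration (irrelevant for the theorem)
T (suc m) = length (filter (isToroidal? m) (allVecs (suc m) (suc m)))

{-# OPTIONS --safe #-}

-- Put s = 2^k, so that s² = -1 modulo n = 4^k + 1 and ℤ_n behaves like the
-- Gaussian integers. If f permutes ℤ_n so that every orbit is a point or a
-- square b → b+t → b+t+st → b+st → b, then the queens (x , s f²(x)) form a
-- toroidal configuration, because x - s f²(x) = (1 - s) f(x),
-- x + s f²(x) = (1 + s) f³(x), and s, 1 - s, 1 + s are units. The
-- configuration determines f. Fix M corners b, about n/24 of them, and choose
-- sides t for them one after the other: the other three corners of a square
-- must avoid the fewer than 4M points already used or reserved, which leaves at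
-- least n - 12M sides. So T(n) ≥ c^M with c = (n - 1)/2.

module Submission where

open import Defs
open import Data.Nat using (ℕ; suc; _*_; _^_; _≤_)
open import Data.Product using (Σ; _×_)

open import Data.Nat using (zero; _+_; _∸_; _%_; _/_; _<_; _⊔_; pred; z≤n; s≤s; NonZero)
import Data.Nat.Properties as ℕ
import Data.Nat.DivMod as ℕ
import Data.Nat.Divisibility as ℕ∣
open import Data.Nat.Tactic.RingSolver using () renaming (solve-∀ to solveℕ-∀)
open import Data.Integer as ℤ using (ℤ; +_)
import Data.Integer.Properties as ℤ
import Data.Integer.DivMod as ℤ
open import Data.Integer.Divisibility.Signed using (_∣_; divides; ∣⇒∣ᵤ; ∣m∣n⇒∣m+n; ∣m∣n⇒∣m-n; ∣n⇒∣m*n; ∣-refl)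
open import Data.Integer.Tactic.RingSolver using (solve-∀)
open import Data.Fin using (Fin; zero; suc; toℕ; fromℕ<; inject≤; punchIn; remQuot; combine)
open import Data.Fin.Properties using (toℕ<n; toℕ-fromℕ<; toℕ-injective; any?; _≟_; punchIn-injective; punchInᵢ≢i;
  inject≤-injective; injective⇒≤; combine-remQuot)
open import Data.Vec using (Vec; []; _∷_; tabulate; lookup)
open import Data.Vec.Properties using (lookup∘tabulate)
open import Data.Vec.Functional using (Vector; updateAt)
open import Data.Vec.Functional.Properties using (updateAt-updates; updateAt-minimal)
open import Data.List as List using (List; []; _∷_; length; _++_; allFin)
open import Data.List.Properties using (length-++; length-tabulate)
open import Data.List.Membership.Propositional using (_∈_; _∉_)
open import Data.List.Membership.Propositional.Properties using (∈-map⁺; ∈-allFin; ∈-concatMap⁺; ∈-filter⁺; ∈-++⁺ˡ; ∈-++⁺ʳ)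
open import Data.List.Relation.Unary.Any as Any using (here; there)
open import Data.List.Relation.Unary.Any.Properties using (lookup-index)
open import Data.List.Relation.Unary.All using ([]; _∷_)
open import Data.List.Relation.Unary.All.Properties using (All¬⇒¬Any)
open import Data.List.Relation.Unary.AllPairs using ([]; _∷_)
open import Data.List.Relation.Unary.Unique.Propositional using (Unique)
open import Data.List.Relation.Unary.Unique.Propositional.Properties using (tabulate⁺)
open import Data.Product using (_,_; proj₁; proj₂)
open import Function using (_∘_; const)
open import Relation.Nullary using (yes; no; contradiction)
open import Relation.Binary.PropositionalEquality

-- Injections

∈-allVecs : ∀ {l k} (v : Vec (Fin k) l) → v ∈ allVecs l k
∈-allVecs []      = here refl
∈-allVecs {suc l} {k} (i ∷ v) =
  ∈-concatMap⁺ (λ u → List.map (_∷ u) (allFin k))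
    (Any.map (λ { refl → ∈-map⁺ (_∷ v) (∈-allFin i) }) (∈-allVecs v))

injection⇒≤length : ∀ {A : Set} {N} {xs : List A} (f : Fin N → A) →
  (∀ {i j} → f i ≡ f j → i ≡ j) → (∀ i → f i ∈ xs) → N ≤ length xs
injection⇒≤length {xs = xs} f f-inj f∈ = injective⇒≤ {f = λ i → Any.index (f∈ i)} λ {i} {j} eq →
  f-inj (trans (lookup-index (f∈ i)) (trans (cong (List.lookup xs) eq) (sym (lookup-index (f∈ j)))))

injection⇒≤T : ∀ {m N} (f : Fin N → Vec (Fin (suc m)) (suc m)) →
  (∀ {i j} → f i ≡ f j → i ≡ j) → (∀ i → IsToroidal m (f i)) → N ≤ T (suc m)
injection⇒≤T {m} f f-inj f-toroidal =
  injection⇒≤length f f-inj λ i → ∈-filter⁺ (isToroidal? m) (∈-allVecs (f i)) (f-toroidal i)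

-- By injectivity each `v` in `V` is the value of at most one index. `punchIn` drops that index, so
-- every entry of `V` costs one index and at least `c` survive.
avoid : ∀ {n c} (V : List (Fin n)) (f : Fin (length V + c) → Fin n) → (∀ {i j} → f i ≡ f j → i ≡ j) →
  Σ (Fin c → Fin (length V + c)) λ g → (∀ {i j} → g i ≡ g j → i ≡ j) × (∀ j → f (g j) ∉ V)
avoid [] f f-inj = (λ j → j) , (λ eq → eq) , λ _ ()
avoid {n} {c} (v ∷ V) f f-inj = p ∘ g , g-inj ∘ punchIn-injective skip _ _ ,
    λ { j (here eq) → punchInᵢ≢i skip (g j) (proj₂ hit eq) ; j (there ∈V) → g-avoids j ∈V }
  where
  hit : Σ (Fin (suc (length V + c))) λ i → ∀ {j} → f j ≡ v → j ≡ i
  hit with any? (λ i → f i ≟ v)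
  ... | yes (i , fi≡v) = i , λ fj≡v → f-inj (trans fj≡v (sym fi≡v))
  -- No index hits `v`; index `zero` is dropped all the same, so that the count falls by exactly one
  -- in both cases.
  ... | no  v∉f        = zero , λ fj≡v → contradiction (_ , fj≡v) v∉f
  skip = proj₁ hit
  p = punchIn skip
  IH = avoid V (f ∘ p) (punchIn-injective skip _ _ ∘ f-inj)
  g = proj₁ IH
  g-inj = proj₁ (proj₂ IH)
  g-avoids = proj₂ (proj₂ IH)

-- Three successive sievings, each on the indices that survived the previous one; each costs
-- `length V`.
avoid₃ : ∀ {n c} (V : List (Fin n)) (f₁ f₂ f₃ : Fin n → Fin n) →
  (∀ {i j} → f₁ i ≡ f₁ j → i ≡ j) → (∀ {i j} → f₂ i ≡ f₂ j → i ≡ j) → (∀ {i j} → f₃ i ≡ f₃ j → i ≡ j) →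
  length V + (length V + (length V + c)) ≤ n →
  Σ (Fin c → Fin n) λ g → (∀ {i j} → g i ≡ g j → i ≡ j) ×
    (∀ j → f₁ (g j) ∉ V) × (∀ j → f₂ (g j) ∉ V) × (∀ j → f₃ (g j) ∉ V)
avoid₃ V f₁ f₂ f₃ inj₁ inj₂ inj₃ room
  with h₁ , h₁-inj , avoids₁ ← avoid V (λ j → f₁ (inject≤ j room))
         (λ eq → inject≤-injective room room _ _ (inj₁ eq))
  with h₂ , h₂-inj , avoids₂ ← avoid V (λ j → f₂ (inject≤ (h₁ j) room))
         (λ eq → h₁-inj (inject≤-injective room room _ _ (inj₂ eq)))
  with h₃ , h₃-inj , avoids₃ ← avoid V (λ j → f₃ (inject≤ (h₁ (h₂ j)) room))
         (λ eq → h₂-inj (h₁-inj (inject≤-injective room room _ _ (inj₃ eq))))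
  = (λ j → inject≤ (h₁ (h₂ (h₃ j))) room) ,
    (λ eq → h₃-inj (h₂-inj (h₁-inj (inject≤-injective room room _ _ eq)))) ,
    (λ j → avoids₁ (h₂ (h₃ j))) , (λ j → avoids₂ (h₃ j)) , avoids₃

_[_↦_] : ∀ {n} {A : Set} → Vector A n → Fin n → A → Vector A n
f [ i ↦ a ] = updateAt f i (const a)

module _ (m : ℕ) (s half : ℤ)
         (s²≈-1 : + suc m ∣ s ℤ.* s ℤ.+ + 1)
         (2*half≈1 : + suc m ∣ + 2 ℤ.* half ℤ.- + 1) where

  n : ℕ
  n = suc m

  -- Arithmetic modulo n

  ι : Fin n → ℤ
  ι x = + toℕ x

  abstract
    reduce : ℤ → Fin n
    reduce a = fromℕ< (ℤ.n%ℕd<d a n)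

    ι-reduce : ∀ a → + n ∣ ι (reduce a) ℤ.- a
    ι-reduce a = subst (+ n ∣_) (sym eq) (∣n⇒∣m*n (ℤ.- (a ℤ./ℕ n)) ∣-refl)
      where
      lemma : ∀ r q N → r ℤ.- (r ℤ.+ q ℤ.* N) ≡ (ℤ.- q) ℤ.* N
      lemma = solve-∀
      eq : ι (reduce a) ℤ.- a ≡ (ℤ.- (a ℤ./ℕ n)) ℤ.* + n
      eq = trans (cong₂ (λ u v → + u ℤ.- v) (toℕ-fromℕ< (ℤ.n%ℕd<d a n)) (ℤ.a≡a%ℕn+[a/ℕn]*n a n))
                 (lemma (+ (a ℤ.%ℕ n)) (a ℤ./ℕ n) (+ n))

  -- Representatives lie in `[0, n)`, so their difference has absolute value below `n`, and a
  -- multiple of `n` that small is 0.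
  ι-injective : ∀ {x y} → + n ∣ ι x ℤ.- ι y → x ≡ y
  ι-injective {x} {y} n∣x-y = toℕ-injective (ℤ.+-injective (ℤ.i-j≡0⇒i≡j _ _ (ℤ.∣i∣≡0⇒i≡0 dist≡0)))
    where
    dist<n : ℤ.∣ ι x ℤ.- ι y ∣ < n
    dist<n = ℕ.≤-<-trans (subst (λ z → ℤ.∣ z ∣ ≤ toℕ x ⊔ toℕ y) (sym (ℤ.m-n≡m⊖n (toℕ x) (toℕ y))) (ℤ.∣m⊝n∣≤m⊔n (toℕ x) (toℕ y)))
                         (ℕ.⊔-lub (toℕ<n x) (toℕ<n y))
    dist≡0 : ℤ.∣ ι x ℤ.- ι y ∣ ≡ 0
    dist≡0 with ℤ.∣ ι x ℤ.- ι y ∣ | dist<n | ∣⇒∣ᵤ n∣x-y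
    ... | zero  | _ | _   = refl
    ... | suc d | d<n | n∣d = contradiction (ℕ∣.∣⇒≤ n∣d) (ℕ.<⇒≱ d<n)

  reduce≡⇒∣ : ∀ a b → reduce a ≡ reduce b → + n ∣ a ℤ.- b
  reduce≡⇒∣ a b eq = subst (+ n ∣_) (lemma (ι (reduce b)) a b)
      (∣m∣n⇒∣m-n (ι-reduce b) (subst (λ r → + n ∣ ι r ℤ.- a) eq (ι-reduce a)))
    where
    lemma : ∀ r a b → (r ℤ.- b) ℤ.- (r ℤ.- a) ≡ a ℤ.- b
    lemma = solve-∀

  %≡⇒∣ : ∀ a b → a % n ≡ b % n → + n ∣ + a ℤ.- + b
  %≡⇒∣ a b eq = divides (+ (a / n) ℤ.- + (b / n))
      (trans (cong₂ ℤ._-_ (expand a) (trans (expand b) (cong (λ r → + r ℤ.+ + (b / n) ℤ.* + n) (sym eq))))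
             (lemma (+ (a % n)) (+ (a / n)) (+ (b / n)) (+ n)))
    where
    expand : ∀ a → + a ≡ + (a % n) ℤ.+ + (a / n) ℤ.* + n
    expand a = trans (cong +_ (ℕ.m≡m%n+[m/n]*n a n))
                     (trans (ℤ.pos-+ (a % n) _) (cong (λ z → + (a % n) ℤ.+ z) (ℤ.pos-* (a / n) n)))
    lemma : ∀ r p q N → (r ℤ.+ p ℤ.* N) ℤ.- (r ℤ.+ q ℤ.* N) ≡ (p ℤ.- q) ℤ.* N
    lemma = solve-∀

  record Unit (r : ℤ) : Set where
    constructor _,_
    field
      inverse   : ℤ
      inverseʳ : + n ∣ r ℤ.* inverse ℤ.- + 1

  cancel : ∀ {r} → Unit r → ∀ u → + n ∣ r ℤ.* u → + n ∣ u
  cancel {r} (r⁻¹ , rr⁻¹≈1) u n∣ru =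
      subst (+ n ∣_) (lemma r r⁻¹ u) (∣m∣n⇒∣m-n (∣n⇒∣m*n r⁻¹ n∣ru) (∣n⇒∣m*n u rr⁻¹≈1))
    where
    lemma : ∀ r r⁻¹ u → r⁻¹ ℤ.* (r ℤ.* u) ℤ.- u ℤ.* (r ℤ.* r⁻¹ ℤ.- + 1) ≡ u
    lemma = solve-∀

  unit-1 : Unit (+ 1)
  unit-1 = + 1 , divides (+ 0) refl

  unit-s : Unit s
  unit-s = ℤ.- s , subst (+ n ∣_) (lemma s) (∣n⇒∣m*n (ℤ.- + 1) s²≈-1)
    where
    lemma : ∀ s → (ℤ.- + 1) ℤ.* (s ℤ.* s ℤ.+ + 1) ≡ s ℤ.* (ℤ.- s) ℤ.- + 1
    lemma = solve-∀

  -- `(1 + s)(1 - s) = 1 - s²` is congruent to 2, so half of either factor inverts the other.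
  unit-1+s : Unit (+ 1 ℤ.+ s)
  unit-1+s = half ℤ.* (+ 1 ℤ.- s) , subst (+ n ∣_) (lemma s half) (∣m∣n⇒∣m-n 2*half≈1 (∣n⇒∣m*n half s²≈-1))
    where
    lemma : ∀ s h → (+ 2 ℤ.* h ℤ.- + 1) ℤ.- h ℤ.* (s ℤ.* s ℤ.+ + 1) ≡ (+ 1 ℤ.+ s) ℤ.* (h ℤ.* (+ 1 ℤ.- s)) ℤ.- + 1
    lemma = solve-∀

  unit-1-s : Unit (+ 1 ℤ.- s)
  unit-1-s = half ℤ.* (+ 1 ℤ.+ s) , subst (+ n ∣_) (lemma s half) (∣m∣n⇒∣m-n 2*half≈1 (∣n⇒∣m*n half s²≈-1))
    where
    lemma : ∀ s h → (+ 2 ℤ.* h ℤ.- + 1) ℤ.- h ℤ.* (s ℤ.* s ℤ.+ + 1) ≡ (+ 1 ℤ.- s) ℤ.* (h ℤ.* (+ 1 ℤ.+ s)) ℤ.- + 1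
    lemma = solve-∀

  -- Squares

  -- x, y, z are consecutive corners of a possibly degenerate square: turning
  -- the side x → y by a right angle (multiplying by s) gives the side y → z.
  record Turn (x y z : ℤ) : Set where
    constructor turn
    field right-angle : + n ∣ (z ℤ.- y) ℤ.- s ℤ.* (y ℤ.- x)

  turn-const : ∀ x → Turn x x x
  turn-const x = turn (divides (+ 0) (lemma s x))
    where
    lemma : ∀ s x → (x ℤ.- x) ℤ.- s ℤ.* (x ℤ.- x) ≡ + 0
    lemma = solve-∀

  turn-first : ∀ {x x' y z} → Turn x y z → Turn x' y z → + n ∣ x ℤ.- x'
  turn-first {x} {x'} {y} {z} (turn h) (turn h') = cancel unit-s (x ℤ.- x') (subst (+ n ∣_) (lemma s x x' y z) (∣m∣n⇒∣m-n h h'))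
    where
    lemma : ∀ s x x' y z → ((z ℤ.- y) ℤ.- s ℤ.* (y ℤ.- x)) ℤ.- ((z ℤ.- y) ℤ.- s ℤ.* (y ℤ.- x')) ≡ s ℤ.* (x ℤ.- x')
    lemma = solve-∀

  -- Subtracting the two relations leaves `(1 + s)(y - y')`. This is what recovers a rotation from
  -- its square, hence from its configuration.
  turn-middle : ∀ {x y y' z} → Turn x y z → Turn x y' z → + n ∣ y ℤ.- y'
  turn-middle {x} {y} {y'} {z} (turn h) (turn h') =
      cancel unit-1+s (y ℤ.- y') (subst (+ n ∣_) (lemma s x y y' z) (∣m∣n⇒∣m-n h' h))
    where
    lemma : ∀ s x y y' z → ((z ℤ.- y') ℤ.- s ℤ.* (y' ℤ.- x)) ℤ.- ((z ℤ.- y) ℤ.- s ℤ.* (y ℤ.- x)) ≡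
                           (+ 1 ℤ.+ s) ℤ.* (y ℤ.- y')
    lemma = solve-∀

  -- With `d = y - x` the four sides are `d`, `s d`, `s² d`, `s³ d`, and their sum is
  -- `(1 + s)(1 + s²) d`, congruent to 0. The other coefficients in `lemma` carry the error of each
  -- turn through the sides that follow it.
  turn-closed : ∀ {x y z w v} → Turn x y z → Turn y z w → Turn z w v → + n ∣ v ℤ.- x
  turn-closed {x} {y} {z} {w} {v} (turn h₁) (turn h₂) (turn h₃) = subst (+ n ∣_) (sym (lemma s x y z w v))
      (∣m∣n⇒∣m+n (∣m∣n⇒∣m+n (∣n⇒∣m*n ((+ 1 ℤ.+ s) ℤ.* (y ℤ.- x)) s²≈-1) (∣n⇒∣m*n (+ 1 ℤ.+ s ℤ.+ s ℤ.* s) h₁))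
                 (∣m∣n⇒∣m+n (∣n⇒∣m*n (+ 1 ℤ.+ s) h₂) h₃))
    where
    lemma : ∀ s x y z w v → v ℤ.- x ≡
      ((+ 1 ℤ.+ s) ℤ.* (y ℤ.- x) ℤ.* (s ℤ.* s ℤ.+ + 1) ℤ.+ (+ 1 ℤ.+ s ℤ.+ s ℤ.* s) ℤ.* ((z ℤ.- y) ℤ.- s ℤ.* (y ℤ.- x)))
      ℤ.+ ((+ 1 ℤ.+ s) ℤ.* ((w ℤ.- z) ℤ.- s ℤ.* (z ℤ.- y)) ℤ.+ ((v ℤ.- w) ℤ.- s ℤ.* (w ℤ.- z)))
    lemma = solve-∀

  -- Multiply `z = y + s (y - x)` by `s` and replace `s²` by -1. For `y = f x`, `z = f (f x)` this
  -- is the difference diagonal of the queen in row `x`.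
  turn-diff : ∀ {x y z} → Turn x y z → + n ∣ (x ℤ.- s ℤ.* z) ℤ.- (+ 1 ℤ.- s) ℤ.* y
  turn-diff {x} {y} {z} (turn h) = subst (+ n ∣_) (lemma s x y z) (∣m∣n⇒∣m-n (∣n⇒∣m*n (x ℤ.- y) s²≈-1) (∣n⇒∣m*n s h))
    where
    lemma : ∀ s x y z → (x ℤ.- y) ℤ.* (s ℤ.* s ℤ.+ + 1) ℤ.- s ℤ.* ((z ℤ.- y) ℤ.- s ℤ.* (y ℤ.- x)) ≡
                        (x ℤ.- s ℤ.* z) ℤ.- (+ 1 ℤ.- s) ℤ.* y
    lemma = solve-∀

  turn-sum : ∀ {z w x} → Turn z w x → + n ∣ (x ℤ.+ s ℤ.* z) ℤ.- (+ 1 ℤ.+ s) ℤ.* w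
  turn-sum {z} {w} {x} (turn h) = subst (+ n ∣_) (lemma s z w x) h
    where
    lemma : ∀ s z w x → (x ℤ.- w) ℤ.- s ℤ.* (w ℤ.- z) ≡ (x ℤ.+ s ℤ.* z) ℤ.- (+ 1 ℤ.+ s) ℤ.* w
    lemma = solve-∀

  abstract
    corner : ℤ → Fin n → Fin n → Fin n
    corner r b t = reduce (ι b ℤ.+ r ℤ.* ι t)

    ι-corner : ∀ r b t → + n ∣ ι (corner r b t) ℤ.- (ι b ℤ.+ r ℤ.* ι t)
    ι-corner r b t = ι-reduce (ι b ℤ.+ r ℤ.* ι t)

    corner-injective : ∀ {r} → Unit r → ∀ b {t t'} → corner r b t ≡ corner r b t' → t ≡ t'
    corner-injective {r} u b {t} {t'} eq = ι-injective (cancel u (ι t ℤ.- ι t')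
        (subst (+ n ∣_) (lemma (ι b) r (ι t) (ι t')) (reduce≡⇒∣ (ι b ℤ.+ r ℤ.* ι t) (ι b ℤ.+ r ℤ.* ι t') eq)))
      where
      lemma : ∀ b r t t' → (b ℤ.+ r ℤ.* t) ℤ.- (b ℤ.+ r ℤ.* t') ≡ r ℤ.* (t ℤ.- t')
      lemma = solve-∀

    -- Equality of the two corners gives `(r - r') t` congruent to 0, hence `t` too: the square is
    -- degenerate. So a side with `p ≢ b` has four distinct corners.
    corner-collision : ∀ r r' → Unit (r ℤ.- r') → ∀ b t → corner r b t ≡ corner r' b t → corner (+ 1) b t ≡ b
    corner-collision r r' u b t eq = ι-injective (subst (+ n ∣_) (lemma′ (ι (corner (+ 1) b t)) (ι b) (ι t))
        (∣m∣n⇒∣m+n (ι-reduce (ι b ℤ.+ + 1 ℤ.* ι t))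
                   (cancel u (ι t) (subst (+ n ∣_) (lemma (ι b) r r' (ι t))
                     (reduce≡⇒∣ (ι b ℤ.+ r ℤ.* ι t) (ι b ℤ.+ r' ℤ.* ι t) eq)))))
      where
      lemma : ∀ b r r' t → (b ℤ.+ r ℤ.* t) ℤ.- (b ℤ.+ r' ℤ.* t) ≡ (r ℤ.- r') ℤ.* t
      lemma = solve-∀
      lemma′ : ∀ c b t → (c ℤ.- (b ℤ.+ + 1 ℤ.* t)) ℤ.+ t ≡ c ℤ.- b
      lemma′ = solve-∀

  module _ (b t p q r : ℤ) (p≈ : + n ∣ p ℤ.- (b ℤ.+ + 1 ℤ.* t))
           (q≈ : + n ∣ q ℤ.- (b ℤ.+ (+ 1 ℤ.+ s) ℤ.* t)) (r≈ : + n ∣ r ℤ.- (b ℤ.+ s ℤ.* t)) where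

    -- Going round, the sides are `t`, `s t`, `-t`, `-s t`. The turns at `q` and `b`, from `s t` to
    -- `-t` and from `-s t` to `t`, are the ones that use `s² = -1`.
    turn-bpq : Turn b p q
    turn-bpq = turn (subst (+ n ∣_) (lemma s b t p q) (∣m∣n⇒∣m-n q≈ (∣n⇒∣m*n (+ 1 ℤ.+ s) p≈)))
      where
      lemma : ∀ s b t p q → (q ℤ.- (b ℤ.+ (+ 1 ℤ.+ s) ℤ.* t)) ℤ.- (+ 1 ℤ.+ s) ℤ.* (p ℤ.- (b ℤ.+ + 1 ℤ.* t)) ≡
                            (q ℤ.- p) ℤ.- s ℤ.* (p ℤ.- b)
      lemma = solve-∀

    turn-pqr : Turn p q r
    turn-pqr = turn (subst (+ n ∣_) (lemma s b t p q r)
        (∣m∣n⇒∣m+n (∣m∣n⇒∣m-n r≈ (∣n⇒∣m*n (+ 1 ℤ.+ s) q≈)) (∣m∣n⇒∣m-n (∣n⇒∣m*n s p≈) (∣n⇒∣m*n t s²≈-1))))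
      where
      lemma : ∀ s b t p q r →
        ((r ℤ.- (b ℤ.+ s ℤ.* t)) ℤ.- (+ 1 ℤ.+ s) ℤ.* (q ℤ.- (b ℤ.+ (+ 1 ℤ.+ s) ℤ.* t)))
          ℤ.+ (s ℤ.* (p ℤ.- (b ℤ.+ + 1 ℤ.* t)) ℤ.- t ℤ.* (s ℤ.* s ℤ.+ + 1))
        ≡ (r ℤ.- q) ℤ.- s ℤ.* (q ℤ.- p)
      lemma = solve-∀

    turn-qrb : Turn q r b
    turn-qrb = turn (subst (+ n ∣_) (lemma s b t q r) (∣m∣n⇒∣m-n (∣n⇒∣m*n s q≈) (∣n⇒∣m*n (+ 1 ℤ.+ s) r≈)))
      where
      lemma : ∀ s b t q r →
        s ℤ.* (q ℤ.- (b ℤ.+ (+ 1 ℤ.+ s) ℤ.* t)) ℤ.- (+ 1 ℤ.+ s) ℤ.* (r ℤ.- (b ℤ.+ s ℤ.* t))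
        ≡ (b ℤ.- r) ℤ.- s ℤ.* (r ℤ.- q)
      lemma = solve-∀

    turn-rbp : Turn r b p
    turn-rbp = turn (subst (+ n ∣_) (lemma s b t p r) (∣m∣n⇒∣m+n (∣m∣n⇒∣m+n p≈ (∣n⇒∣m*n s r≈)) (∣n⇒∣m*n t s²≈-1)))
      where
      lemma : ∀ s b t p r →
        ((p ℤ.- (b ℤ.+ + 1 ℤ.* t)) ℤ.+ s ℤ.* (r ℤ.- (b ℤ.+ s ℤ.* t))) ℤ.+ t ℤ.* (s ℤ.* s ℤ.+ + 1)
        ≡ (p ℤ.- b) ℤ.- s ℤ.* (b ℤ.- r)
      lemma = solve-∀

  -- Rotations: maps whose orbits are points or squares

  Rotation : (Fin n → Fin n) → Set
  Rotation f = ∀ x → Turn (ι x) (ι (f x)) (ι (f (f x)))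

  -- Equal images have equal second images, so the turns at `x` and `y` share their last two
  -- corners, and these determine the first.
  rotation-injective : ∀ {f} → Rotation f → ∀ {x y} → f x ≡ f y → x ≡ y
  rotation-injective {f} rot {x} {y} eq =
    ι-injective (turn-first (rot x) (subst (λ z → Turn (ι y) (ι z) (ι (f z))) (sym eq) (rot y)))

  rotation-fourth-power : ∀ {f} → Rotation f → ∀ x → f (f (f (f x))) ≡ x
  rotation-fourth-power {f} rot x = ι-injective (turn-closed (rot x) (rot (f x)) (rot (f (f x))))

  rotation-determined-by-square : ∀ {f g} → Rotation f → Rotation g →
    (∀ x → f (f x) ≡ g (g x)) → ∀ x → f x ≡ g x
  rotation-determined-by-square {f} {g} rot-f rot-g eq x =
    ι-injective (turn-middle (rot-f x) (subst (λ z → Turn (ι x) (ι (g x)) (ι z)) (sym (eq x)) (rot-g x)))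

  module Rotate (f : Fin n → Fin n) {b p q r : Fin n}
                (p≢b : p ≢ b) (q≢b : q ≢ b) (q≢p : q ≢ p) (r≢b : r ≢ b) (r≢p : r ≢ p) (r≢q : r ≢ q) where

    rotated : Fin n → Fin n
    rotated = f [ r ↦ b ] [ q ↦ r ] [ p ↦ q ] [ b ↦ p ]

    rotated-b : rotated b ≡ p
    rotated-b = updateAt-updates b _

    rotated-p : rotated p ≡ q
    rotated-p = trans (updateAt-minimal p b _ p≢b) (updateAt-updates p _)

    rotated-q : rotated q ≡ r
    rotated-q = trans (updateAt-minimal q b _ q≢b) (trans (updateAt-minimal q p _ q≢p) (updateAt-updates q _))

    rotated-r : rotated r ≡ b
    rotated-r = trans (updateAt-minimal r b _ r≢b) (trans (updateAt-minimal r p _ r≢p)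
                (trans (updateAt-minimal r q _ r≢q) (updateAt-updates r f)))

    rotated-other : ∀ {x} → x ≢ b → x ≢ p → x ≢ q → x ≢ r → rotated x ≡ f x
    rotated-other {x} x≢b x≢p x≢q x≢r = trans (updateAt-minimal x b _ x≢b) (trans (updateAt-minimal x p _ x≢p)
                (trans (updateAt-minimal x q _ x≢q) (updateAt-minimal x r f x≢r)))

    module _ (rot : Rotation f) (fb : f b ≡ b) (fp : f p ≡ p) (fq : f q ≡ q) (fr : f r ≡ r)
             (bpq : Turn (ι b) (ι p) (ι q)) (pqr : Turn (ι p) (ι q) (ι r))
             (qrb : Turn (ι q) (ι r) (ι b)) (rbp : Turn (ι r) (ι b) (ι p)) where

      private
        along : ∀ {x y z} → rotated x ≡ y → rotated y ≡ z → Turn (ι x) (ι y) (ι z) →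
               Turn (ι x) (ι (rotated x)) (ι (rotated (rotated x)))
        along refl refl h = h

        -- A fixed point `c` has only itself as preimage. Hence `f` maps the complement of the four
        -- corners into itself, and there the new map makes the same turns as `f`.
        moves-off : ∀ {x c} → f c ≡ c → x ≢ c → f x ≢ c
        moves-off fc≡c x≢c fx≡c = x≢c (rotation-injective rot (trans fx≡c (sym fc≡c)))

      rotated-rotation : Rotation rotated
      rotated-rotation x with x ≟ b | x ≟ p | x ≟ q | x ≟ r
      ... | yes refl | _ | _ | _ = along rotated-b rotated-p bpq
      ... | no _ | yes refl | _ | _ = along rotated-p rotated-q pqr
      ... | no _ | no _ | yes refl | _ = along rotated-q rotated-r qrb
      ... | no _ | no _ | no _ | yes refl = along rotated-r rotated-b rbp
      ... | no x≢b | no x≢p | no x≢q | no x≢r = along (rotated-other x≢b x≢p x≢q x≢r)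
        (rotated-other (moves-off fb x≢b) (moves-off fp x≢p) (moves-off fq x≢q) (moves-off fr x≢r)) (rot x)

  -- Counting rotations

  -- A lower bound `N` for the number of rotations extending `f` restricted to `U`, given as an
  -- injective indexing. `distinct` compares members pointwise, because propositional equality of
  -- functions is finer.
  record Family (U : List (Fin n)) (f : Fin n → Fin n) (N : ℕ) : Set where
    field
      member   : Fin N → Fin n → Fin n
      rotation : ∀ i → Rotation (member i)
      agrees   : ∀ i {x} → x ∈ U → member i x ≡ f x
      distinct : ∀ {i j} → (∀ x → member i x ≡ member j x) → i ≡ j

  open Family

  singleton : ∀ {U f} → Rotation f → Family U f 1
  singleton {f = f} rot = record
    { member = const f ; rotation = const rot ; agrees = λ _ _ → refl ; distinct = λ { {zero} {zero} _ → refl } }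

  -- Members from different branches differ at `b`, where each takes the value prescribed by its
  -- branch; members of one branch are separated by its own family. So the counts multiply.
  branch : ∀ {U f c N} (b : Fin n) {U′ : Fin c → List (Fin n)} {f′ : Fin c → Fin n → Fin n} →
    (∀ j {x} → x ∈ U → x ∈ U′ j) → (∀ j {x} → x ∈ U → f′ j x ≡ f x) →
    (∀ j → b ∈ U′ j) → (∀ {i j} → f′ i b ≡ f′ j b → i ≡ j) →
    (∀ j → Family (U′ j) (f′ j) N) → Family U f (c * N)
  branch {c = c} {N} b U⊆U′ f′≡f b∈U′ f′b-inj Φ = record
    { member   = λ i → member (Φ (first i)) (rest i)
    ; rotation = λ i → rotation (Φ (first i)) (rest i)
    ; agrees   = λ i x∈U → trans (agrees (Φ (first i)) (rest i) (U⊆U′ (first i) x∈U)) (f′≡f (first i) x∈U)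
    ; distinct = λ {i} {j} eq → trans (sym (combine-remQuot {c} N i))
        (trans (same _ _ _ _ eq) (combine-remQuot {c} N j))
    }
    where
    first : Fin (c * N) → Fin c
    first i = proj₁ (remQuot {c} N i)
    rest : Fin (c * N) → Fin N
    rest i = proj₂ (remQuot {c} N i)
    same : ∀ i j k l → (∀ x → member (Φ i) k x ≡ member (Φ j) l x) → combine i k ≡ combine j l
    same i j k l eq
      with f′b-inj (trans (sym (agrees (Φ i) k (b∈U′ i))) (trans (eq b) (agrees (Φ j) l (b∈U′ j))))
    ... | refl = cong (combine i) (distinct (Φ i) eq)

  private
    1+s-1 : ∀ s → s ≡ (+ 1 ℤ.+ s) ℤ.- + 1
    1+s-1 = solve-∀
    1+s-s : ∀ s → + 1 ≡ (+ 1 ℤ.+ s) ℤ.- s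
    1+s-s = solve-∀


  private
    -- Here `u` points are used and `suc m` base corners remain, the present one included, so the
    -- list to avoid has length `suc m + u`. Since `3 (u + 4 (m + 1)) = 3 (m + 1 + u) + 9 + 9 m`,
    -- the bound can afford the slack 9, which is exact at the last corner, `m = 0`.
    room : ∀ u m c → 3 * (u + 4 * suc m) + c ≤ n + 9 →
      (suc m + u) + ((suc m + u) + ((suc m + u) + c)) ≤ n
    room u m c h = ℕ.+-cancelʳ-≤ 9 _ _
      (ℕ.≤-trans (ℕ.m≤m+n _ (9 * m)) (subst (_≤ n + 9) (lemma u m c) h))
      where
      lemma : ∀ u m c → 3 * (u + 4 * suc m) + c ≡ (suc m + u) + ((suc m + u) + ((suc m + u) + c)) + 9 + 9 * m
      lemma = solveℕ-∀

    room-next : ∀ u m c → 3 * (u + 4 * suc m) + c ≤ n + 9 → 3 * ((4 + u) + 4 * m) + c ≤ n + 9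
    room-next u m c = subst (_≤ n + 9) (lemma u m c)
      where
      lemma : ∀ u m c → 3 * (u + 4 * suc m) + c ≡ 3 * ((4 + u) + 4 * m) + c
      lemma = solveℕ-∀

  extend : ∀ {f} → Rotation f → ∀ {b} t → f b ≡ b →
    (let p = corner (+ 1) b t; q = corner (+ 1 ℤ.+ s) b t; r = corner s b t) →
    p ≢ b → q ≢ b → r ≢ b → f p ≡ p → f q ≡ q → f r ≡ r →
    Σ (Fin n → Fin n) λ g → Rotation g × g b ≡ p × (∀ {x} → x ≢ b → x ≢ p → x ≢ q → x ≢ r → g x ≡ f x)
  extend {f} rot {b} t fb p≢b q≢b r≢b fp fq fr =
      rotated , rotated-rotation rot fb fp fq fr
        (turn-bpq (ι b) (ι t) (ι p) (ι q) (ι r) p≈ q≈ r≈) (turn-pqr (ι b) (ι t) (ι p) (ι q) (ι r) p≈ q≈ r≈)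
        (turn-qrb (ι b) (ι t) (ι p) (ι q) (ι r) p≈ q≈ r≈) (turn-rbp (ι b) (ι t) (ι p) (ι q) (ι r) p≈ q≈ r≈) ,
      rotated-b , rotated-other
    where
    p = corner (+ 1) b t
    q = corner (+ 1 ℤ.+ s) b t
    r = corner s b t
    p≈ = ι-corner (+ 1) b t
    q≈ = ι-corner (+ 1 ℤ.+ s) b t
    r≈ = ι-corner s b t
    -- The coefficients `1 + s`, `1`, `s` of `q`, `p`, `r` have pairwise differences `s`, `1 - s`,
    -- `1` up to sign, all units, so `p ≢ b` keeps these corners apart.
    open Rotate f p≢b q≢b
      (λ eq → p≢b (corner-collision (+ 1 ℤ.+ s) (+ 1) (subst Unit (1+s-1 s) unit-s) b t eq)) r≢b
      (λ eq → p≢b (corner-collision (+ 1) s unit-1-s b t (sym eq)))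
      (λ eq → p≢b (corner-collision (+ 1 ℤ.+ s) s (subst Unit (1+s-s s) unit-1) b t (sym eq)))

  -- U holds the points of the squares placed so far and bs the base corners
  -- still to be used; U grows by 4 for each of them.
  family : ∀ {c} bs U f → Rotation f → (∀ {x} → x ∉ U → f x ≡ x) →
    Unique bs → (∀ {x} → x ∈ bs → x ∉ U) → 3 * (length U + 4 * length bs) + c ≤ n + 9 →
    Family U f (c ^ length bs)
  family [] U f rot _ _ _ _ = singleton rot
  family {c} (b ∷ bs) U f rot fixes (b∉bs ∷ bs-unique) bs∉U fits =
      step (avoid₃ V (corner (+ 1) b) (corner (+ 1 ℤ.+ s) b) (corner s b)
        (corner-injective unit-1 b) (corner-injective unit-1+s b) (corner-injective unit-s b) room′)
    where
    -- Besides the used points, new corners must avoid `b`, to be nondegenerate, and the later base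
    -- corners `bs`, which have to stay fixed until their turn.
    V = b ∷ bs ++ U
    room′ : length V + (length V + (length V + c)) ≤ n
    room′ rewrite length-++ bs {U} = room (length U) (length bs) c fits
    fixes-∉V : ∀ {x} → x ∉ V → f x ≡ x
    fixes-∉V x∉V = fixes (x∉V ∘ there ∘ ∈-++⁺ʳ bs)

    step : (Σ (Fin c → Fin n) λ side → (∀ {i j} → side i ≡ side j → i ≡ j) ×
      (∀ j → corner (+ 1) b (side j) ∉ V) × (∀ j → corner (+ 1 ℤ.+ s) b (side j) ∉ V) ×
      (∀ j → corner s b (side j) ∉ V)) → Family U f (c * c ^ length bs)
    step (side , side-inj , p∉V , q∉V , r∉V) =
        branch b (λ _ → there ∘ there ∘ there ∘ there) g≡f (λ _ → here refl)
          -- The value at `b` is the corner `b + t`, which reveals the chosen side `t`.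
          (λ {i} {j} eq → side-inj (corner-injective unit-1 b (trans (sym (g-b i)) (trans eq (g-b j)))))
          (λ j → family bs (U′ j) (g j) (g-rotation j) (g-fixes j) bs-unique (bs∉U′ j)
                   (room-next (length U) (length bs) c fits))
      where
      p = λ j → corner (+ 1) b (side j)
      q = λ j → corner (+ 1 ℤ.+ s) b (side j)
      r = λ j → corner s b (side j)
      U′ : Fin c → List (Fin n)
      U′ j = b ∷ p j ∷ q j ∷ r j ∷ U
      extension : ∀ j → Σ (Fin n → Fin n) λ g → Rotation g × g b ≡ p j ×
        (∀ {x} → x ≢ b → x ≢ p j → x ≢ q j → x ≢ r j → g x ≡ f x)
      extension j = extend rot (side j) (fixes (bs∉U (here refl)))
        (p∉V j ∘ here) (q∉V j ∘ here) (r∉V j ∘ here) (fixes-∉V (p∉V j)) (fixes-∉V (q∉V j)) (fixes-∉V (r∉V j))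
      g : Fin c → Fin n → Fin n
      g j = proj₁ (extension j)
      g-rotation : ∀ j → Rotation (g j)
      g-rotation j = proj₁ (proj₂ (extension j))
      g-b : ∀ j → g j b ≡ p j
      g-b j = proj₁ (proj₂ (proj₂ (extension j)))
      g-other : ∀ j {x} → x ≢ b → x ≢ p j → x ≢ q j → x ≢ r j → g j x ≡ f x
      g-other j = proj₂ (proj₂ (proj₂ (extension j)))
      ∉V⇒≢ : ∀ {x y} → x ∉ V → y ∈ U → y ≢ x
      ∉V⇒≢ x∉V y∈U refl = x∉V (there (∈-++⁺ʳ bs y∈U))
      g≡f : ∀ j {x} → x ∈ U → g j x ≡ f x
      g≡f j x∈U = g-other j (λ { refl → bs∉U (here refl) x∈U })
        (∉V⇒≢ (p∉V j) x∈U) (∉V⇒≢ (q∉V j) x∈U) (∉V⇒≢ (r∉V j) x∈U)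
      g-fixes : ∀ j {x} → x ∉ U′ j → g j x ≡ x
      g-fixes j x∉ = trans (g-other j (x∉ ∘ here) (x∉ ∘ there ∘ here) (x∉ ∘ there ∘ there ∘ here)
        (x∉ ∘ there ∘ there ∘ there ∘ here)) (fixes (x∉ ∘ there ∘ there ∘ there ∘ there))
      bs∉U′ : ∀ j {x} → x ∈ bs → x ∉ U′ j
      bs∉U′ j x∈bs (here refl) = All¬⇒¬Any b∉bs x∈bs
      bs∉U′ j x∈bs (there (here refl)) = p∉V j (there (∈-++⁺ˡ x∈bs))
      bs∉U′ j x∈bs (there (there (here refl))) = q∉V j (there (∈-++⁺ˡ x∈bs))
      bs∉U′ j x∈bs (there (there (there (here refl)))) = r∉V j (there (∈-++⁺ˡ x∈bs))
      bs∉U′ j x∈bs (there (there (there (there x∈U)))) = bs∉U (there x∈bs) x∈U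

  -- The configuration of a rotation

  private
    square-column : (Fin n → Fin n) → Fin n → Fin n
    square-column f x = reduce (s ℤ.* ι (f (f x)))

  configuration : (Fin n → Fin n) → Vec (Fin n) n
  configuration f = tabulate (square-column f)

  private
    multiple-injective : ∀ {r} → Unit r → ∀ {x y} → + n ∣ r ℤ.* ι x ℤ.- r ℤ.* ι y → x ≡ y
    multiple-injective {r} u {x} {y} h = ι-injective (cancel u (ι x ℤ.- ι y) (subst (+ n ∣_) (lemma r (ι x) (ι y)) h))
      where
      lemma : ∀ r x y → r ℤ.* x ℤ.- r ℤ.* y ≡ r ℤ.* (x ℤ.- y)
      lemma = solve-∀

    column-injective : ∀ {f g} x y → square-column f x ≡ square-column g y → f (f x) ≡ g (g y)
    column-injective {f} {g} x y eq = multiple-injective unit-s (reduce≡⇒∣ (s ℤ.* ι (f (f x))) (s ℤ.* ι (g (g y))) eq)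

  configuration-injective : ∀ {f g} → Rotation f → Rotation g → configuration f ≡ configuration g → ∀ x → f x ≡ g x
  configuration-injective {f} {g} rot-f rot-g eq = rotation-determined-by-square rot-f rot-g λ x →
    column-injective {f} {g} x x (trans (sym (lookup∘tabulate (square-column f) x))
      (trans (cong (λ v → lookup v x) eq) (lookup∘tabulate (square-column g) x)))

  configuration-toroidal : ∀ {f} → Rotation f → IsToroidal m (configuration f)
  configuration-toroidal {f} rot = columns , sums , differences
    where
    queen = square-column f
    f-inj : ∀ {x y} → f x ≡ f y → x ≡ y
    f-inj = rotation-injective rot

    columns : Injective (λ x → toℕ (lookup (configuration f) x))
    columns i j eq rewrite lookup∘tabulate queen i | lookup∘tabulate queen j =
      f-inj (f-inj (column-injective {f} {f} i j (toℕ-injective eq)))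

    sums : Injective (λ x → (toℕ x + toℕ (lookup (configuration f) x)) % suc m)
    sums i j eq rewrite lookup∘tabulate queen i | lookup∘tabulate queen j =
        f-inj (f-inj (f-inj (multiple-injective unit-1+s (subst (+ n ∣_)
          (lemma s (ι i) (ι j) (ι (queen i)) (ι (queen j)) (ι (f (f i))) (ι (f (f j))) (ι (f (f (f i)))) (ι (f (f (f j)))))
          (∣m∣n⇒∣m+n (%≡⇒∣ (toℕ i + toℕ (queen i)) (toℕ j + toℕ (queen j)) eq) (∣m∣n⇒∣m-n (near j) (near i)))))))
      where
      -- The `s f²(x)` terms cancel, leaving row plus column minus `(1 + s) f³(x)`. The turn used is
      -- `f²(x)`, `f³(x)`, `f⁴(x) = x`.
      near : ∀ x → + n ∣ (ι (queen x) ℤ.- s ℤ.* ι (f (f x))) ℤ.+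
                        ((ι x ℤ.+ s ℤ.* ι (f (f x))) ℤ.- (+ 1 ℤ.+ s) ℤ.* ι (f (f (f x))))
      near x = ∣m∣n⇒∣m+n (ι-reduce (s ℤ.* ι (f (f x))))
        (turn-sum (subst (λ z → Turn (ι (f (f x))) (ι (f (f (f x)))) (ι z)) (rotation-fourth-power rot x) (rot (f (f x)))))
      lemma : ∀ s i j qi qj i₂ j₂ i₃ j₃ → ((i ℤ.+ qi) ℤ.- (j ℤ.+ qj)) ℤ.+
        (((qj ℤ.- s ℤ.* j₂) ℤ.+ ((j ℤ.+ s ℤ.* j₂) ℤ.- (+ 1 ℤ.+ s) ℤ.* j₃)) ℤ.-
         ((qi ℤ.- s ℤ.* i₂) ℤ.+ ((i ℤ.+ s ℤ.* i₂) ℤ.- (+ 1 ℤ.+ s) ℤ.* i₃)))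
        ≡ (+ 1 ℤ.+ s) ℤ.* i₃ ℤ.- (+ 1 ℤ.+ s) ℤ.* j₃
      lemma = solve-∀

    differences : Injective (λ x → (toℕ x + (suc m ∸ toℕ (lookup (configuration f) x))) % suc m)
    differences i j eq rewrite lookup∘tabulate queen i | lookup∘tabulate queen j =
        f-inj (multiple-injective unit-1-s (subst (+ n ∣_)
          (trans (cong₂ (λ u v → (u ℤ.- v) ℤ.+ (b ℤ.- a)) (pos-diff i) (pos-diff j))
                 (lemma s (+ n) (ι i) (ι j) (ι (queen i)) (ι (queen j)) (ι (f (f i))) (ι (f (f j))) (ι (f i)) (ι (f j))))
          (∣m∣n⇒∣m+n (%≡⇒∣ (toℕ i + (n ∸ toℕ (queen i))) (toℕ j + (n ∸ toℕ (queen j))) eq)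
                     (∣m∣n⇒∣m-n (near j) (near i)))))
      where
      -- After cancellation this is row minus column minus `(1 - s) f(x)`.
      remainder : Fin n → ℤ
      remainder x = ((ι x ℤ.- s ℤ.* ι (f (f x))) ℤ.- (+ 1 ℤ.- s) ℤ.* ι (f x)) ℤ.- (ι (queen x) ℤ.- s ℤ.* ι (f (f x)))
      a = remainder i
      b = remainder j
      near : ∀ x → + n ∣ remainder x
      near x = ∣m∣n⇒∣m-n (turn-diff (rot x)) (ι-reduce (s ℤ.* ι (f (f x))))
      -- The truncated subtraction is a true one because a column is below `n`; the two copies of
      -- `n` cancel between `i` and `j`.
      pos-diff : ∀ x → + (toℕ x + (n ∸ toℕ (queen x))) ≡ ι x ℤ.+ (+ n ℤ.- ι (queen x))
      pos-diff x = trans (ℤ.pos-+ (toℕ x) _) (cong (λ z → ι x ℤ.+ z)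
        (sym (trans (ℤ.m-n≡m⊖n n (toℕ (queen x))) (ℤ.⊖-≥ (ℕ.<⇒≤ (toℕ<n (queen x)))))))
      lemma : ∀ s N i j qi qj i₂ j₂ i₁ j₁ →
        ((i ℤ.+ (N ℤ.- qi)) ℤ.- (j ℤ.+ (N ℤ.- qj))) ℤ.+
        ((((j ℤ.- s ℤ.* j₂) ℤ.- (+ 1 ℤ.- s) ℤ.* j₁) ℤ.- (qj ℤ.- s ℤ.* j₂)) ℤ.-
         (((i ℤ.- s ℤ.* i₂) ℤ.- (+ 1 ℤ.- s) ℤ.* i₁) ℤ.- (qi ℤ.- s ℤ.* i₂)))
        ≡ (+ 1 ℤ.- s) ℤ.* i₁ ℤ.- (+ 1 ℤ.- s) ℤ.* j₁
      lemma = solve-∀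

  -- The construction starts from the identity, all of whose squares are degenerate, with no point
  -- used and `0, ..., M - 1` as base corners.
  power≤T : ∀ {M c} → 12 * M + c ≤ n + 9 → c ^ M ≤ T n
  power≤T {M} {c} fits = injection⇒≤T (configuration ∘ member Φ)
      (λ {i} {j} eq → distinct Φ (configuration-injective (rotation Φ i) (rotation Φ j) eq))
      (λ i → configuration-toroidal (rotation Φ i))
    where
    M≤n : M ≤ n
    -- If `M > n`, then `12 M` is at least `12 n + 12`, which exceeds `n + 9`.
    M≤n with M ℕ.≤? n
    ... | yes h = h
    ... | no  h = contradiction fits (ℕ.<⇒≱ (ℕ.<-≤-trans (12M>n+9 (ℕ.≰⇒> h)) (ℕ.m≤m+n _ c)))
      where
      12M>n+9 : n < M → n + 9 < 12 * M
      12M>n+9 n<M = ℕ.<-≤-trans (subst (n + 9 <_) (lemma n) (ℕ.m≤m+n (suc (n + 9)) (11 * n + 2))) (ℕ.*-monoʳ-≤ 12 n<M)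
        where
        lemma : ∀ n → suc (n + 9) + (11 * n + 2) ≡ 12 * suc n
        lemma = solveℕ-∀
    bs : List (Fin n)
    bs = List.tabulate {n = M} (λ i → inject≤ i M≤n)
    bs-fit : 3 * (0 + 4 * length bs) + c ≤ n + 9
    bs-fit = subst (λ l → 3 * (0 + 4 * l) + c ≤ n + 9) (sym (length-tabulate {n = M} _))
                   (subst (λ z → z + c ≤ n + 9) (ℕ.*-assoc 3 4 M) fits)
    Φ : Family [] (λ x → x) (c ^ M)
    Φ = subst (λ l → Family [] (λ x → x) (c ^ l)) (length-tabulate {n = M} _)
          (family bs [] (λ x → x) (λ x → turn-const (ι x)) (λ _ → refl)
            (tabulate⁺ (λ {i} {j} → inject≤-injective M≤n M≤n i j)) (λ _ ()) bs-fit)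

-- Numerical estimates and the constant

N^N≤t^ae : ∀ N c e a M t .{{_ : NonZero N}} → N ≤ c ^ e → N ≤ a * M → c ^ M ≤ t → N ^ N ≤ t ^ (a * e)
N^N≤t^ae N c e a M t N≤c^e N≤aM c^M≤t = begin
  N ^ N               ≤⟨ ℕ.^-monoʳ-≤ N N≤aM ⟩
  N ^ (a * M)         ≤⟨ ℕ.^-monoˡ-≤ (a * M) N≤c^e ⟩
  (c ^ e) ^ (a * M)   ≡⟨ ℕ.^-*-assoc c e (a * M) ⟩
  c ^ (e * (a * M))   ≡⟨ cong (c ^_) (lemma e a M) ⟩
  c ^ (M * (a * e))   ≡⟨ ℕ.^-*-assoc c M (a * e) ⟨
  (c ^ M) ^ (a * e)   ≤⟨ ℕ.^-monoˡ-≤ (a * e) c^M≤t ⟩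
  t ^ (a * e)         ∎
  where
  open ℕ.≤-Reasoning
  lemma : ∀ e a M → e * (a * M) ≡ M * (a * e)
  lemma = solveℕ-∀

-- The exponent 3 is forced by `w = 1`, where 5 lies between `2²` and `2³`.
4w+1≤[2w]³ : ∀ v → suc (4 * suc v) ≤ (2 * suc v) ^ 3
4w+1≤[2w]³ v = subst (suc (4 * suc v) ≤_) (sym (lemma v)) (ℕ.m≤m+n _ _)
  where
  lemma : ∀ v → (2 * suc v) * ((2 * suc v) * ((2 * suc v) * 1)) ≡
                suc (4 * suc v) + (8 * v * v * v + 24 * v * v + 20 * v + 3)
  lemma = solveℕ-∀

-- With `w = suc v` and `M = suc (v / 6)`, division with remainder gives `w ≤ 6 M`, and
-- `4 w + 1 ≤ 5 w`.
4w+1≤30M : ∀ v → suc (4 * suc v) ≤ 30 * suc (v / 6)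
4w+1≤30M v = begin
  suc (4 * suc v)       ≤⟨ ℕ.m≤m+n _ v ⟩
  suc (4 * suc v) + v   ≡⟨ lemma₁ v ⟩
  5 * suc v             ≤⟨ ℕ.*-monoʳ-≤ 5 v<6M ⟩
  5 * (suc (v / 6) * 6) ≡⟨ lemma₂ (v / 6) ⟩
  30 * suc (v / 6)      ∎
  where
  open ℕ.≤-Reasoning
  lemma₁ : ∀ v → suc (4 * suc v) + v ≡ 5 * suc v
  lemma₁ = solveℕ-∀
  lemma₂ : ∀ d → 5 * (suc d * 6) ≡ 30 * suc d
  lemma₂ = solveℕ-∀
  v<6M : v < suc (v / 6) * 6
  v<6M = subst (_< suc (v / 6) * 6) (sym (ℕ.m≡m%n+[m/n]*n v 6)) (ℕ.+-monoˡ-< (v / 6 * 6) (ℕ.m%n<n v 6))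

-- For `w = suc v = h²` and `n = 4 w + 1`, the choice `s = 2 h` gives `s² + 1 = n` exactly, and
-- `half = 2 w + 1` gives `2 half = n + 1`. With `c = 2 w`, `suc (v / 6)` is the largest `M`
-- satisfying `12 M + c ≤ n + 9`.
power≤T-of-square : ∀ h v → h * h ≡ suc v → (2 * suc v) ^ suc (v / 6) ≤ T (suc (4 * suc v))
power≤T-of-square h v h²≡ = power≤T (4 * suc v) (+ (2 * h)) (+ suc (2 * suc v))
    (subst (+ suc (4 * suc v) ∣_) s²+1 ∣-refl) (subst (+ suc (4 * suc v) ∣_) 2half-1 ∣-refl) {suc (v / 6)} {2 * suc v} fits
  where
  s²+1 : + suc (4 * suc v) ≡ + (2 * h) ℤ.* + (2 * h) ℤ.+ + 1
  s²+1 = trans (cong +_ (trans (cong (λ w → suc (4 * w)) (sym h²≡)) (lemma h)))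
               (trans (ℤ.pos-+ (2 * h * (2 * h)) 1) (cong (ℤ._+ + 1) (ℤ.pos-* (2 * h) (2 * h))))
    where
    lemma : ∀ h → suc (4 * (h * h)) ≡ 2 * h * (2 * h) + 1
    lemma = solveℕ-∀
  2half-1 : + suc (4 * suc v) ≡ + 2 ℤ.* + suc (2 * suc v) ℤ.- + 1
  2half-1 = sym (trans (cong (ℤ._- + 1) (trans (sym (ℤ.pos-* 2 (suc (2 * suc v)))) (cong +_ (lemma v)))) refl)
    where
    lemma : ∀ v → 2 * suc (2 * suc v) ≡ suc (suc (4 * suc v))
    lemma = solveℕ-∀
  fits : 12 * suc (v / 6) + 2 * suc v ≤ suc (4 * suc v) + 9
  fits = begin
    12 * suc (v / 6) + 2 * suc v         ≡⟨ lemma₁ (v / 6) v ⟩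
    2 * (v / 6 * 6) + (2 * v + 14)       ≤⟨ ℕ.+-monoˡ-≤ (2 * v + 14) (ℕ.*-monoʳ-≤ 2 (ℕ.m/n*n≤m v 6)) ⟩
    2 * v + (2 * v + 14)                 ≡⟨ lemma₂ v ⟩
    suc (4 * suc v) + 9                  ∎
    where
    open ℕ.≤-Reasoning
    lemma₁ : ∀ d v → 12 * suc d + 2 * suc v ≡ 2 * (d * 6) + (2 * v + 14)
    lemma₁ = solveℕ-∀
    lemma₂ : ∀ v → 2 * v + (2 * v + 14) ≡ suc (4 * suc v) + 9
    lemma₂ = solveℕ-∀

-- q is a variable because Agda would unfold T n ^ 90 with a literal exponent.
power-bound : ∀ q → q ≡ 30 * 3 → ∀ h v x → h * h ≡ suc v → x ≡ 4 * suc v →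
  suc x ^ (1 * suc x) ≤ T (suc x) ^ q
power-bound q q≡ h v x h²≡ refl =
  subst₂ (λ e d → N ^ e ≤ T N ^ d) (sym (ℕ.*-identityˡ N)) (sym q≡)
    (N^N≤t^ae N (2 * suc v) 3 30 (suc (v / 6)) (T N) (4w+1≤[2w]³ v) (4w+1≤30M v) (power≤T-of-square h v h²≡))
  where
  N = suc x

4^[1+j] : ∀ j → 2 ^ (2 * suc j) ≡ 4 * (2 ^ j * 2 ^ j)
4^[1+j] j = trans (cong (2 ^_) (lemma j)) (trans (ℕ.^-distribˡ-+-* 2 2 (j + j)) (cong (4 *_) (ℕ.^-distribˡ-+-* 2 j j)))
  where
  lemma : ∀ j → 2 * suc j ≡ 2 + (j + j)
  lemma = solveℕ-∀

theorem1 : Σ ℕ (λ p → Σ ℕ (λ q → 1 ≤ p × 1 ≤ q ×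
    ((k : ℕ) → 1 ≤ k →
    (suc (2 ^ (2 * k))) ^ (p * suc (2 ^ (2 * k)))
    ≤ T (suc (2 ^ (2 * k))) ^ q)))
-- The exponent constant is `1/90`: the factor 30 comes from `n ≤ 30 M` and the factor 3 from
-- `n ≤ c³`.
theorem1 = 1 , 90 , s≤s z≤n , s≤s z≤n , bound 90 refl
  where
  bound : ∀ q → q ≡ 30 * 3 → (k : ℕ) → 1 ≤ k →
    suc (2 ^ (2 * k)) ^ (1 * suc (2 ^ (2 * k))) ≤ T (suc (2 ^ (2 * k))) ^ q
  -- For `k = j + 1` and `h = 2 ^ j` one has `4 ^ k = 4 h²`, so the root of -1 in use is
  -- `2 h = 2 ^ k`.
  bound q q≡ (suc j) _ = power-bound q q≡ h (pred (h * h)) (2 ^ (2 * suc j)) h²≡ (trans (4^[1+j] j) (cong (4 *_) h²≡))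
    where
    h = 2 ^ j
    instance
      h-nonZero : NonZero h
      h-nonZero = ℕ.m^n≢0 2 j
      h²-nonZero : NonZero (h * h)
      h²-nonZero = ℕ.m*n≢0 h h
    h²≡ : h * h ≡ suc (pred (h * h))
    h²≡ = sym (ℕ.suc-pred (h * h))
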